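{- Let $a,b$ be positive integers with $a\equiv 0\pmod b$, let $n\geq 1$, and let $G$ be a regular graph. If $aG\circ nK_1$ is distance magic, then $bG\circ \frac{a}{b}(nK_1)$ is distance magic.
   Context: A graph $G$ on $v$ vertices is distance magic if there is a bijection $f:V(G)\to\{1,\ldots,v\}$ and a constant $k$ such that for every vertex $x$, $\sum_{y\in N(x)}f(y)=k$, where $N(x)$ is the set of neighbours of $x$. For a positive integer $c$, $cH$ denotes the disjoint union of $c$ copies of $H$; $nK_1$ is the edgeless graph on $n$ vertices (so $\frac{a}{b}(nK_1)$ is the edgeless graph on $\frac{an}{b}$ vertices). The lexicographic product $G\circ H$ has vertex set $V(G)\times V(H)$, with $(g,h)$ adjacent to $(g',h')$ iff either $gg'\in E(G)$, or $g=g'$ and $hh'\in E(H)$. -}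

module Defs where

open import Data.Empty using (⊥)
open import Data.Fin using (Fin; toℕ)
open import Data.Fin.Properties using (*↔×; 1↔⊤) renaming (_≟_ to _≟ᶠ_)
open import Data.List using (List; allFin; filter; length; map)
open import Data.Nat using (ℕ; suc; _*_)
open import Data.Nat.ListAction using (sum)
open import Data.Product using (∃-syntax; _×_; _,_; proj₁; proj₂)
open import Data.Product.Function.NonDependent.Propositional using (_×-↔_)
open import Data.Sum using (_⊎_; inj₁; inj₂)
open import Data.Unit using (⊤)
open import Function.Bundles using (_↔_; _⤖_; module Inverse; module Bijection)
open import Function.Construct.Composition using (_↔-∘_)
open import Function.Construct.Identity using (↔-id)
open import Function.Construct.Symmetry using (↔-sym)
open import Function.Properties.Inverse using (↔⇒↣)
open import Relation.Binary.Definitions using (Decidable; DecidableEquality; Irreflexive; Symmetric)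
open import Relation.Binary.PropositionalEquality using (_≡_; refl; sym)
open import Relation.Nullary.Decidable using (no; via-injection; _×-dec_; _⊎-dec_)

-- Finite simple graphs. The enumeration only witnesses that there are
-- exactly `order` vertices.
record Graph : Set₁ where
  field
    V           : Set
    order       : ℕ
    enumeration : V ↔ Fin order
    _~_         : V → V → Set
    _~?_        : Decidable _~_
    ~-sym       : Symmetric _~_
    ~-irrefl    : Irreflexive _≡_ _~_

  _≟_ : DecidableEquality V
  _≟_ = via-injection (↔⇒↣ enumeration) _≟ᶠ_

  vertices : List V
  vertices = map (Inverse.from enumeration) (allFin order)

  neighbours : V → List V
  neighbours x = filter (x ~?_) vertices

  degree : V → ℕ
  degree x = length (neighbours x)

Regular : Graph → Set
Regular G = ∃[ r ] (∀ x → degree x ≡ r)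
  where open Graph G

-- A bijection V(G) → {1,…,v} is a bijection onto Fin v = {0,…,v-1}
-- followed by the shift i ↦ i + 1.
DistanceMagic : Graph → Set
DistanceMagic G =
  ∃[ f ] ∃[ k ] (∀ x → sum (map (label f) (neighbours x)) ≡ k)
  where
  open Graph G
  label : V ⤖ Fin order → V → ℕ
  label f y = suc (toℕ (Bijection.to f y))

K₁ : Graph
K₁ = record
  { V           = ⊤
  ; order       = 1
  ; enumeration = ↔-sym 1↔⊤
  ; _~_         = λ _ _ → ⊥
  ; _~?_        = λ _ _ → no λ ()
  ; ~-sym       = λ ()
  ; ~-irrefl    = λ _ ()
  }

infixr 8 _·_
infixl 7 _∘ₗ_

-- c · H is the disjoint union of c copies of H; G ∘ₗ H is the lexicographic product.
_·_ : ℕ → Graph → Graph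
c · H = record
  { V           = Fin c × V
  ; order       = c * order
  ; enumeration = ↔-sym *↔× ↔-∘ (↔-id (Fin c) ×-↔ enumeration)
  ; _~_         = λ x y → proj₁ x ≡ proj₁ y × proj₂ x ~ proj₂ y
  ; _~?_        = λ x y → (proj₁ x ≟ᶠ proj₁ y) ×-dec (proj₂ x ~? proj₂ y)
  ; ~-sym       = λ (i≡j , x~y) → sym i≡j , ~-sym x~y
  ; ~-irrefl    = λ { refl (_ , x~x) → ~-irrefl refl x~x }
  }
  where open Graph H

_∘ₗ_ : Graph → Graph → Graph
G ∘ₗ H = record
  { V           = G.V × H.V
  ; order       = G.order * H.order
  ; enumeration = ↔-sym *↔× ↔-∘ (G.enumeration ×-↔ H.enumeration)
  ; _~_         = λ x y → (proj₁ x G.~ proj₁ y) ⊎ (proj₁ x ≡ proj₁ y × proj₂ x H.~ proj₂ y)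
  ; _~?_        = λ x y → (proj₁ x G.~? proj₁ y) ⊎-dec
                          ((proj₁ x G.≟ proj₁ y) ×-dec (proj₂ x H.~? proj₂ y))
  ; ~-sym       = λ { (inj₁ g~g′)         → inj₁ (G.~-sym g~g′)
                    ; (inj₂ (g≡g′ , h~h′)) → inj₂ (sym g≡g′ , H.~-sym h~h′) }
  ; ~-irrefl    = λ { refl (inj₁ g~g)       → G.~-irrefl refl g~g
                    ; refl (inj₂ (_ , h~h)) → H.~-irrefl refl h~h }
  }
  where
  module G = Graph G
  module H = Graph H

{-# OPTIONS --safe #-}

-- Write q = a / b and identify Fin a with Fin b × Fin q.  Then bG ∘ q(nK₁) and
-- aG ∘ nK₁ have the same vertices, and the neighbourhood of (j , g , t , h) in the
-- former is the disjoint union over s < q of the neighbourhoods of ((j , s) , g , h)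
-- in the latter.  So a distance magic labelling of aG ∘ nK₁ with constant k is, read
-- on bG ∘ q(nK₁), distance magic with constant q k.
module Submission where

open import Defs
open import Data.Bool using (if_then_else_)
open import Data.Fin using (Fin; zero; suc; toℕ; combine; punchIn)
open import Data.Fin.Permutation using (↔⇒≡; cast-id)
open import Data.Fin.Properties using (*↔×; combine-injective; punchInᵢ≢i; toℕ-cast)
open import Data.List using (filter; map; tabulate)
open import Data.List.Properties using (map-cong; map-tabulate)
open import Data.Nat using (ℕ; zero; suc; _+_; _*_; _≥_; NonZero)
open import Data.Nat.DivMod using (_/_; _%_; m/n*n≡m)
open import Data.Nat.Divisibility using (m%n≡0⇒n∣m)
import Data.Nat.ListAction as List
open import Data.Nat.Properties using (+-0-commutativeMonoid; +-identityʳ; *-comm)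
open import Data.Product using (_,_; proj₁; proj₂; ∃!)
open import Data.Sum using (inj₁; inj₂)
open import Function using (_∘_; id)
open import Function.Bundles using (_↔_; _⤖_; mk↔ₛ′; module Inverse; module Bijection)
open import Function.Construct.Composition using (_↔-∘_; _⤖-∘_)
open import Function.Construct.Symmetry using (↔-sym)
open import Function.Properties.Inverse using (↔⇒⤖)
open import Relation.Binary.PropositionalEquality using (_≡_; refl; sym; trans; cong; cong₂; subst; module ≡-Reasoning)
open import Relation.Nullary using (¬_; Dec; yes; no; does; contradiction)
open import Relation.Unary using (Decidable)

open import Algebra.Properties.CommutativeMonoid.Sum +-0-commutativeMonoid

open Graph using (V)

private
  variable
    A : Set

-- Masked weights turn sums over filtered lists into sums over a whole `Fin n`, where terms can be
-- removed, swapped and reindexed.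
restrict : Dec A → ℕ → ℕ
restrict A? w = if does A? then w else 0

restrict-true : (A? : Dec A) → A → ∀ w → restrict A? w ≡ w
restrict-true (yes _) _ w = refl
restrict-true (no ¬a) a w = contradiction a ¬a

restrict-false : (A? : Dec A) → ¬ A → ∀ w → restrict A? w ≡ 0
restrict-false (yes a) ¬a w = contradiction a ¬a
restrict-false (no _)  _  w = refl

∑-restrict-∄ : ∀ {n} {P : Fin n → Set} (P? : Decidable P) (w : ℕ) →
               (∀ i → ¬ P i) → ∑[ i < n ] restrict (P? i) w ≡ 0
∑-restrict-∄ {n} P? w ¬P = trans
  (sum-cong-≗ (λ i → restrict-false (P? i) (¬P i) w))
  (sum-replicate-zero n)

-- Once the witness `i` is taken out of the sum, the remaining indices have the form `punchIn i j`,
-- differ from `i`, and so contribute 0 by uniqueness.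
∑-restrict-∃! : ∀ {n} {P : Fin n → Set} (P? : Decidable P) (w : ℕ) →
                ∃! _≡_ P → ∑[ i < n ] restrict (P? i) w ≡ w
∑-restrict-∃! {suc n} P? w (i , Pi , unique) = begin
  ∑[ j < suc n ] restrict (P? j) w
    ≡⟨ sum-remove {i = i} (λ j → restrict (P? j) w) ⟩
  restrict (P? i) w + ∑[ j < n ] restrict (P? (punchIn i j)) w
    ≡⟨ cong₂ _+_ (restrict-true (P? i) Pi w)
                 (∑-restrict-∄ (P? ∘ punchIn i) w λ j Pj → punchInᵢ≢i i j (sym (unique Pj))) ⟩
  w + 0
    ≡⟨ +-identityʳ w ⟩
  w ∎
  where open ≡-Reasoning

sum-filter-tabulate : ∀ {n} {P : A → Set} (P? : Decidable P) (w : A → ℕ) (g : Fin n → A) →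
  List.sum (map w (filter P? (tabulate g))) ≡ ∑[ i < n ] restrict (P? (g i)) (w (g i))
sum-filter-tabulate {n = zero}  P? w g = refl
sum-filter-tabulate {n = suc n} P? w g with P? (g zero)
... | yes _ = cong (w (g zero) +_) (sum-filter-tabulate P? w (g ∘ suc))
... | no _  = sum-filter-tabulate P? w (g ∘ suc)

module _ (G : Graph) where
  open Graph G hiding (V)

  vertex : Fin order → V G
  vertex = Inverse.from enumeration

  sum-neighbours : (w : V G → ℕ) (x : V G) →
    List.sum (map w (neighbours x)) ≡ ∑[ i < order ] restrict (x ~? vertex i) (w (vertex i))
  sum-neighbours w x = trans
    (cong (List.sum ∘ map w ∘ filter (x ~?_)) (map-tabulate id vertex))
    (sum-filter-tabulate (x ~?_) w vertex)

module _ (H K : Graph) (ψ : V H ↔ V K) where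
  private
    module H = Graph H
    module K = Graph K
    open Inverse ψ using (to)

  -- `split` and `merge` encode that `ψ` carries the neighbourhood of `x` onto the disjoint union
  -- over `t` of those of `σ x t`: existence gives covering, uniqueness gives disjointness, and
  -- `merge` excludes anything else.
  module _ {q : ℕ} (σ : V H → Fin q → V K)
           (split : ∀ {x y} → x H.~ y → ∃! _≡_ (λ t → σ x t K.~ to y))
           (merge : ∀ {x y t} → σ x t K.~ to y → x H.~ y) where

    restrict-split : ∀ x y w →
      restrict (x H.~? y) w ≡ ∑[ t < q ] restrict (σ x t K.~? to y) w
    restrict-split x y w with x H.~? y
    ... | yes x~y = sym (∑-restrict-∃! (λ t → σ x t K.~? to y) w (split x~y))
    ... | no ¬x~y = sym (∑-restrict-∄ (λ t → σ x t K.~? to y) w (λ _ → ¬x~y ∘ merge))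

    private
      -- `ψ` need not respect the two enumerations, so sums over indices are matched through this
      -- bijection; it also yields the equality of the orders.
      π : Fin H.order ↔ Fin K.order
      π = K.enumeration ↔-∘ (ψ ↔-∘ ↔-sym H.enumeration)

      vertex-π : ∀ i → vertex K (Inverse.to π i) ≡ to (vertex H i)
      vertex-π i = Inverse.strictlyInverseʳ K.enumeration _

    -- The weight of each neighbour is spread over `t`, where a single term survives; swapping the
    -- two sums then collects, for each `t`, the neighbourhood of `σ x t`.
    sum-neighbours-split : (w : V K → ℕ) (x : V H) →
      List.sum (map (w ∘ to) (H.neighbours x)) ≡
      ∑[ t < q ] List.sum (map w (K.neighbours (σ x t)))
    sum-neighbours-split w x = begin
      List.sum (map (w ∘ to) (H.neighbours x))
        ≡⟨ sum-neighbours H (w ∘ to) x ⟩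
      ∑[ i < H.order ] restrict (x H.~? vertex H i) (w (to (vertex H i)))
        ≡⟨ sum-cong-≗ (λ i → restrict-split x (vertex H i) _) ⟩
      ∑[ i < H.order ] ∑[ t < q ] term t (to (vertex H i))
        ≡⟨ ∑-comm (λ i t → term t (to (vertex H i))) ⟩
      ∑[ t < q ] ∑[ i < H.order ] term t (to (vertex H i))
        ≡⟨ sum-cong-≗ (λ t → sum-cong-≗ (λ i → cong (term t) (vertex-π i))) ⟨
      ∑[ t < q ] ∑[ i < H.order ] term t (vertex K (Inverse.to π i))
        ≡⟨ sum-cong-≗ (λ t → ∑-permute (term t ∘ vertex K) π) ⟨
      ∑[ t < q ] ∑[ i < K.order ] term t (vertex K i)
        ≡⟨ sum-cong-≗ (λ t → sum-neighbours K w (σ x t)) ⟨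
      ∑[ t < q ] List.sum (map w (K.neighbours (σ x t))) ∎
      where
      open ≡-Reasoning
      term : Fin q → V K → ℕ
      term t z = restrict (σ x t K.~? z) (w z)

    DistanceMagic-split : DistanceMagic K → DistanceMagic H
    DistanceMagic-split (f , k , magic) = f′ , ∑[ _ < q ] k , λ x → begin
      List.sum (map (λ y → suc (toℕ (Bijection.to f′ y))) (H.neighbours x))
        ≡⟨ cong List.sum (map-cong (λ y → cong suc (toℕ-cast _ (Bijection.to f (to y)))) (H.neighbours x)) ⟩
      List.sum (map (λ y → suc (toℕ (Bijection.to f (to y)))) (H.neighbours x))
        ≡⟨ sum-neighbours-split (λ z → suc (toℕ (Bijection.to f z))) x ⟩
      ∑[ t < q ] List.sum (map (λ z → suc (toℕ (Bijection.to f z))) (K.neighbours (σ x t)))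
        ≡⟨ sum-cong-≗ (λ t → magic (σ x t)) ⟩
      ∑[ _ < q ] k ∎
      where
      open ≡-Reasoning
      f′ : V H ⤖ Fin H.order
      -- The labels of `f` are pulled back along `ψ`. The last factor casts along the equality of
      -- the orders and preserves `toℕ`, hence every label.
      f′ = ↔⇒⤖ (cast-id (sym (↔⇒≡ π))) ⤖-∘ (f ⤖-∘ ↔⇒⤖ ψ)

module _ (b q : ℕ) (G E : Graph) (edgeless : ∀ {x y} → ¬ Graph._~_ E x y) where
  private
    H K : Graph
    H = (b · G) ∘ₗ (q · E)
    K = ((b * q) · G) ∘ₗ E
    module H = Graph H
    module K = Graph K

  regroup : V H ↔ V K
  regroup = mk↔ₛ′
    (λ ((j , g) , (t , e)) → (combine j t , g) , e)
    (λ ((i , g) , e) → let j , t = Inverse.to *↔× i in (j , g) , (t , e))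
    (λ ((i , g) , e) → cong (λ i → (i , g) , e) (Inverse.strictlyInverseʳ (*↔× {b} {q}) i))
    (λ ((j , g) , (t , e)) →
      cong (λ (j , t) → (j , g) , (t , e)) (Inverse.strictlyInverseˡ (*↔× {b} {q}) (j , t)))

  private
    -- The copy of `E` containing `x` is forgotten, since adjacency in `H` does not see it when `E`
    -- is edgeless; `t` runs over the copies in which a neighbour can lie.
    σ : V H → Fin q → V K
    σ ((j , g) , (_ , e)) t = (combine j t , g) , e

    split : ∀ {x y} → x H.~ y → ∃! _≡_ (λ t → σ x t K.~ Inverse.to regroup y)
    split {(j , _) , _} {(j′ , _) , (t′ , _)} (inj₁ (refl , g~g′)) =
      -- The witness is the copy index of the neighbour; injectivity of `combine` makes it unique.
      t′ , inj₁ (refl , g~g′) , λ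
        { {t} (inj₁ (eq , _)) → sym (proj₂ (combine-injective j t j t′ eq))
        ; (inj₂ (_ , e~e′))   → contradiction e~e′ edgeless }
    split (inj₂ (_ , (_ , e~e′))) = contradiction e~e′ edgeless

    merge : ∀ {x y t} → σ x t K.~ Inverse.to regroup y → x H.~ y
    merge {(j , _) , _} {(j′ , _) , (t′ , _)} {t} (inj₁ (eq , g~g′)) =
      inj₁ (proj₁ (combine-injective j t j′ t′ eq) , g~g′)
    merge (inj₂ (_ , e~e′)) = contradiction e~e′ edgeless

  DistanceMagic-regroup : DistanceMagic K → DistanceMagic H
  DistanceMagic-regroup = DistanceMagic-split H K regroup σ split (λ {x} {y} {t} → merge {x} {y} {t})

theorem15 : (a b n : ℕ) .{{_ : NonZero a}} .{{_ : NonZero b}} → a % b ≡ 0 → n ≥ 1 →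
    (G : Graph) → Regular G →
    DistanceMagic ((a · G) ∘ₗ (n · K₁)) →
    DistanceMagic ((b · G) ∘ₗ ((a / b) · (n · K₁)))
theorem15 a b n a%b≡0 _ G _ magic =
  -- `proj₂` proves edgelessness: an edge of `n · K₁` contains an edge of `K₁`, an element of `⊥`.
  DistanceMagic-regroup b (a / b) G (n · K₁) proj₂
    (subst (λ c → DistanceMagic ((c · G) ∘ₗ (n · K₁))) a≡b*[a/b] magic)
  where
  a≡b*[a/b] : a ≡ b * (a / b)
  a≡b*[a/b] = trans (sym (m/n*n≡m (m%n≡0⇒n∣m a b a%b≡0))) (*-comm (a / b) b)
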